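{- Let $\mathcal{A}$ and $\mathcal{B}$ be classes of structures of the same relational vocabulary with $\mathrm{dom}(\mathcal{A})=\mathrm{dom}(\mathcal{B})$, and let $w$ be a positive integer. Then the following conditions are equivalent: (1) Player I has a winning strategy in the game $\mathrm{EF}_w(\mathcal{A},\mathcal{B})$. (2) There is a first order formula $\phi$ of size $\mathrm{w}(\phi)\le w$ such that $(\mathcal{A},\mathcal{B})\models\phi$.
   Context: Vocabularies are relational; models $\mathfrak{A}$ have nonempty universe $A$. Variables are $x_j$, $j\in\mathbb{N}$. A variable assignment for $\mathfrak{A}$ is a finite partial map $\alpha:\mathbb{N}\to A$ with domain $\mathrm{dom}(\alpha)$. A "structure" here is a pair $(\mathfrak{A},\alpha)$ of a model and an assignment. In a class $\mathcal{A}$ of structures all models have the same vocabulary and all assignments have the same domain, denoted $\mathrm{dom}(\mathcal{A})$ (for classes arising in a game that may be empty, the domain is the one carried along by the position). $(\mathfrak{A},\alpha)\models\phi$ means that $\alpha$ satisfies $\phi$ in $\mathfrak{A}$; this requires $j\in\mathrm{dom}(\alpha)$ for every free variable $x_j$ of $\phi$. First order formulas (with equality) are built from atomic formulas by $\neg,\vee,\wedge,\exists x_j,\forall x_j$. $\alpha(a/j)$ is the assignment mapping $j$ to $a$ and agreeing with $\alpha$ otherwise. For a choice function $F$ on $\mathcal{A}$ (i.e. $F((\mathfrak{A},\alpha))\in A$ for all $(\mathfrak{A},\alpha)\in\mathcal{A}$), $\mathcal{A}(F/j)=\{(\mathfrak{A},\alpha(F((\mathfrak{A},\alpha))/j)):(\mathfrak{A},\alpha)\in\mathcal{A}\}$.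 Also $\mathcal{A}(\star/j)=\{(\mathfrak{A},\alpha(a/j)):(\mathfrak{A},\alpha)\in\mathcal{A},\,a\in A\}$. Separation: $(\mathcal{A},\mathcal{B})\models\phi$ means that the indices of free variables of $\phi$ are in $\mathrm{dom}(\mathcal{A})=\mathrm{dom}(\mathcal{B})$, $(\mathfrak{A},\alpha)\models\phi$ for all $(\mathfrak{A},\alpha)\in\mathcal{A}$, and $(\mathfrak{B},\beta)\not\models\phi$ for all $(\mathfrak{B},\beta)\in\mathcal{B}$. Size: $\mathrm{w}(\phi)=1$ for atomic $\phi$, $\mathrm{w}(\neg\phi)=\mathrm{w}(\phi)$, $\mathrm{w}(\phi\vee\psi)=\mathrm{w}(\phi\wedge\psi)=\mathrm{w}(\phi)+\mathrm{w}(\psi)$, $\mathrm{w}(\exists x_j\phi)=\mathrm{w}(\forall x_j\phi)=\mathrm{w}(\phi)+1$. The game $\mathrm{EF}_w(\mathcal{A},\mathcal{B})$ has players I and II; the initial position is $(w,\mathcal{A},\mathcal{B})$. If in position $(w_m,\mathcal{A}_m,\mathcal{B}_m)$ there is an atomic or negated atomic formula $\phi$ with $(\mathcal{A}_m,\mathcal{B}_m)\models\phi$, the game ends and player I wins. Otherwise, if $w_m=1$, the game ends and player II wins. Otherwise player I makes one of the following moves. Left splitting move: player I chooses integers $u,v\ge1$ with $u+v=w_m$ and writes $\mathcal{A}_m=\mathcal{C}\cup\mathcal{D}$ (parts may be empty); player II chooses whether the game continues from $(u,\mathcal{C},\mathcal{B}_m)$ or $(v,\mathcal{D},\mathcal{B}_m)$.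 Right splitting move: player I chooses integers $u,v\ge1$ with $u+v=w_m$ and writes $\mathcal{B}_m=\mathcal{C}\cup\mathcal{D}$; player II chooses whether the game continues from $(u,\mathcal{A}_m,\mathcal{C})$ or $(v,\mathcal{A}_m,\mathcal{D})$. Left supplementing move: player I chooses $j\in\mathbb{N}$ and a choice function $F$ for $\mathcal{A}_m$; the game continues from $(w_m-1,\mathcal{A}_m(F/j),\mathcal{B}_m(\star/j))$. Right supplementing move: player I chooses $j\in\mathbb{N}$ and a choice function $F$ for $\mathcal{B}_m$; the game continues from $(w_m-1,\mathcal{A}_m(\star/j),\mathcal{B}_m(F/j))$. -}

module Defs where

open import Level using (Level; 0ℓ; _⊔_) renaming (suc to lsuc)
open import Data.Bool using (Bool; true; false)
open import Data.List using (List; _∷_)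
open import Data.List.Membership.Propositional using (_∈_)
open import Data.List.Relation.Unary.Any using (here; there; tail)
open import Data.Nat using (ℕ; _+_; _∸_; _≤_; _≟_)
open import Data.Product using (∃-syntax; Σ-syntax; _×_; _,_)
open import Data.Sum using (_⊎_; inj₁; inj₂)
open import Data.Unit using (⊤)
open import Data.Vec using (Vec; lookup; tabulate)
import Data.Vec.Membership.Propositional as Vecᵐ
open import Data.Vec.Membership.Propositional.Properties using (∈-lookup)
open import Function using (_∘_)
open import Relation.Binary.PropositionalEquality using (_≡_; _≢_; refl)
open import Relation.Nullary using (¬_; yes; no)
open import Relation.Unary using (Pred; _⊆_; _∪_; _≐_)

private
  variable
    a ℓ : Level

record Vocabulary (a : Level) : Set (lsuc a) where
  field
    Symbol : Set a
    arity  : Symbol → ℕ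

open Vocabulary public

-- `nonempty` is irrelevant so that a model does not carry a distinguished
-- point: models differing only in the inhabitant are equal.
record Model (τ : Vocabulary a) (ℓ : Level) : Set (a ⊔ lsuc ℓ) where
  field
    Universe  : Set ℓ
    .nonempty : Universe
    rel       : (R : Symbol τ) → Pred (Vec Universe (arity τ R)) ℓ

open Model public using (Universe; rel)

-- A finite set of variable indices, enumerated with repetitions allowed.
Domain : Set
Domain = List ℕ

-- A finite partial map with domain exactly D.  The membership proof is
-- irrelevant, so the value at j depends on j alone.
Assignment : Domain → Set ℓ → Set ℓ
Assignment D A = (j : ℕ) → .(j ∈ D) → A

_[_/_] : ∀ {D} {A : Set ℓ} → Assignment D A → A → (j : ℕ) → Assignment (j ∷ D) A
(α [ x / j ]) k k∈ with k ≟ j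
... | yes _  = x
... | no k≢j = α k (tail k≢j k∈)

record Structure (τ : Vocabulary a) (ℓ : Level) (D : Domain) : Set (a ⊔ lsuc ℓ) where
  constructor structure
  field
    model      : Model τ ℓ
    assignment : Assignment D (Universe model)

open Structure public

-- All assignments in a class have the same domain D, which the type records
-- even when the class is empty.
Class : Vocabulary a → (ℓ : Level) → Domain → Set (lsuc (a ⊔ lsuc ℓ))
Class {a} τ ℓ D = Pred (Structure τ ℓ D) (a ⊔ lsuc ℓ)

module _ (τ : Vocabulary a) where

  infix  8 _≈_
  infix  7 ¬′_
  infixr 6 _∧_
  infixr 5 _∨_

  data Formula : Set a where
    atom    : (R : Symbol τ) → Vec ℕ (arity τ R) → Formula
    _≈_     : ℕ → ℕ → Formula
    ¬′_     : Formula → Formula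
    _∨_ _∧_ : Formula → Formula → Formula
    ∃′ ∀′   : ℕ → Formula → Formula

module _ {τ : Vocabulary a} where

  data Literal : Formula τ → Set a where
    atom  : ∀ R js → Literal (atom R js)
    eq    : ∀ i j → Literal (i ≈ j)
    ¬atom : ∀ R js → Literal (¬′ (atom R js))
    ¬eq   : ∀ i j → Literal (¬′ (i ≈ j))

  size : Formula τ → ℕ
  size (atom _ _) = 1
  size (_ ≈ _)    = 1
  size (¬′ φ)     = size φ
  size (φ ∨ ψ)    = size φ + size ψ
  size (φ ∧ ψ)    = size φ + size ψ
  size (∃′ _ φ)   = size φ + 1
  size (∀′ _ φ)   = size φ + 1

  Free : Formula τ → Pred ℕ 0ℓ
  Free (atom _ js) k = k Vecᵐ.∈ js
  Free (i ≈ j)     k = k ≡ i ⊎ k ≡ j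
  Free (¬′ φ)      k = Free φ k
  Free (φ ∨ ψ)     k = Free φ k ⊎ Free ψ k
  Free (φ ∧ ψ)     k = Free φ k ⊎ Free ψ k
  Free (∃′ j φ)    k = Free φ k × k ≢ j
  Free (∀′ j φ)    k = Free φ k × k ≢ j

  _ScopedIn_ : Formula τ → Domain → Set
  φ ScopedIn D = Free φ ⊆ (_∈ D)

  bind : ∀ {D} j φ → (λ k → Free φ k × k ≢ j) ⊆ (_∈ D) → φ ScopedIn (j ∷ D)
  bind j φ h {k} x with k ≟ j
  ... | yes k≡j = here k≡j
  ... | no k≢j  = there (h (x , k≢j))

  Sat : ∀ {D} (𝔄 : Model τ ℓ) (α : Assignment D (Universe 𝔄)) (φ : Formula τ) →
        .(φ ScopedIn D) → Set ℓ
  Sat 𝔄 α (atom R js) h =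
    rel 𝔄 R (tabulate λ i → α (lookup js i) (h (∈-lookup i js)))
  Sat 𝔄 α (i ≈ j)  h = α i (h (inj₁ refl)) ≡ α j (h (inj₂ refl))
  Sat 𝔄 α (¬′ φ)   h = ¬ Sat 𝔄 α φ h
  Sat 𝔄 α (φ ∨ ψ)  h = Sat 𝔄 α φ (h ∘ inj₁) ⊎ Sat 𝔄 α ψ (h ∘ inj₂)
  Sat 𝔄 α (φ ∧ ψ)  h = Sat 𝔄 α φ (h ∘ inj₁) × Sat 𝔄 α ψ (h ∘ inj₂)
  Sat 𝔄 α (∃′ j φ) h = ∃[ x ] Sat 𝔄 (α [ x / j ]) φ (bind j φ h)
  Sat 𝔄 α (∀′ j φ) h = ∀ x → Sat 𝔄 (α [ x / j ]) φ (bind j φ h)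

  _⊨_[_] : ∀ {D} → Structure τ ℓ D → (φ : Formula τ) → .(φ ScopedIn D) → Set ℓ
  s ⊨ φ [ h ] = Sat (model s) (assignment s) φ h

  Separates : ∀ {D} → Class τ ℓ D → Class τ ℓ D → Formula τ → Set (a ⊔ lsuc ℓ)
  Separates {D = D} 𝒜 ℬ φ =
    Σ[ h ∈ φ ScopedIn D ] (∀ s → 𝒜 s → s ⊨ φ [ h ]) × (∀ s → ℬ s → ¬ s ⊨ φ [ h ])

  update : ∀ {D} (s : Structure τ ℓ D) → Universe (model s) → (j : ℕ) →
           Structure τ ℓ (j ∷ D)
  update (structure 𝔄 α) x j = structure 𝔄 (α [ x / j ])

  -- Irrelevance of the membership proof makes the choice a function of the
  -- structure alone.
  ChoiceFunction : ∀ {D} → Class τ ℓ D → Set (a ⊔ lsuc ℓ)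
  ChoiceFunction 𝒜 = ∀ s → .(𝒜 s) → Universe (model s)

  _⟨_/_⟩ : ∀ {D} (𝒜 : Class τ ℓ D) → ChoiceFunction 𝒜 → (j : ℕ) → Class τ ℓ (j ∷ D)
  (𝒜 ⟨ F / j ⟩) t = ∃[ s ] Σ[ s∈𝒜 ∈ 𝒜 s ] t ≡ update s (F s s∈𝒜) j

  _⟨⋆/_⟩ : ∀ {D} → Class τ ℓ D → (j : ℕ) → Class τ ℓ (j ∷ D)
  (𝒜 ⟨⋆/ j ⟩) t = ∃[ s ] 𝒜 s × (∃[ x ] t ≡ update s x j)

module _ (τ : Vocabulary a) (ℓ : Level) where

  record Position : Set (lsuc (a ⊔ lsuc ℓ)) where
    constructor position
    field
      {domain}   : Domain
      weight     : ℕ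
      left right : Class τ ℓ domain

module _ {τ : Vocabulary a} {ℓ : Level} where

  open Position

  SeparatedByLiteral : Position τ ℓ → Set (a ⊔ lsuc ℓ)
  SeparatedByLiteral p = ∃[ φ ] Literal φ × Separates (left p) (right p) φ

  data Move (p : Position τ ℓ) : Set (lsuc (a ⊔ lsuc ℓ)) where
    splitˡ : ∀ u v → 1 ≤ u → 1 ≤ v → u + v ≡ weight p →
             (𝒞 𝒟 : Class τ ℓ (domain p)) → left p ≐ 𝒞 ∪ 𝒟 → Move p
    splitʳ : ∀ u v → 1 ≤ u → 1 ≤ v → u + v ≡ weight p →
             (𝒞 𝒟 : Class τ ℓ (domain p)) → right p ≐ 𝒞 ∪ 𝒟 → Move p
    supplementˡ : ℕ → ChoiceFunction (left p) → Move p
    supplementʳ : ℕ → ChoiceFunction (right p) → Move p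

  Reply : ∀ {p} → Move p → Set
  Reply (splitˡ _ _ _ _ _ _ _ _) = Bool
  Reply (splitʳ _ _ _ _ _ _ _ _) = Bool
  Reply (supplementˡ _ _)        = ⊤
  Reply (supplementʳ _ _)        = ⊤

  next : ∀ {p} (m : Move p) → Reply m → Position τ ℓ
  next {p} (splitˡ u v _ _ _ 𝒞 𝒟 _) true  = position u 𝒞 (right p)
  next {p} (splitˡ u v _ _ _ 𝒞 𝒟 _) false = position v 𝒟 (right p)
  next {p} (splitʳ u v _ _ _ 𝒞 𝒟 _) true  = position u (left p) 𝒞
  next {p} (splitʳ u v _ _ _ 𝒞 𝒟 _) false = position v (left p) 𝒟
  next {p} (supplementˡ j F) _ = position (weight p ∸ 1) (left p ⟨ F / j ⟩) (right p ⟨⋆/ j ⟩)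
  next {p} (supplementʳ j F) _ = position (weight p ∸ 1) (left p ⟨⋆/ j ⟩) (right p ⟨ F / j ⟩)

  -- Winning strategies of player I as trees: a move at each position where the
  -- game is not over, with one subtree per reply of player II.  No tree exists
  -- at a position that player II has won (weight 1, not separated by a literal).
  data WinningStrategy (p : Position τ ℓ) : Set (lsuc (a ⊔ lsuc ℓ)) where
    won  : SeparatedByLiteral p → WinningStrategy p
    move : ¬ SeparatedByLiteral p → weight p ≢ 1 →
           (m : Move p) → ((r : Reply m) → WinningStrategy (next m r)) →
           WinningStrategy p

{-# OPTIONS --safe #-}

-- A strategy tree is a formula in negation normal form: left and right splitting
-- moves are ∨ and ∧, left and right supplementing moves are ∃ and ∀, and won
-- positions are literals.  A formula with arbitrary negations yields a strategy
-- because exchanging the two classes dualises strategies without changing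
-- weights, just as negation does not change size.
module Submission where

open import Defs
open import Level using (Level; _⊔_; Lift; lift; lower) renaming (suc to lsuc)
open import Axiom.ExcludedMiddle using (ExcludedMiddle)
open import Data.Bool using (true; false)
open import Data.Empty using (⊥-elim-irr)
open import Data.List.Relation.Unary.Any using (tail)
open import Data.Nat using (ℕ; _+_; _∸_; _≤_)
open import Data.Nat.Properties
open import Data.Product using (∃-syntax; _×_; _,_; proj₁; proj₂)
open import Data.Sum using (inj₁; inj₂; [_,_]; map)
open import Data.Unit using (tt)
open import Function using (_∘_)
open import Function.Bundles using (_⇔_; mk⇔)
open import Relation.Binary.PropositionalEquality using (_≡_; _≢_; refl; sym)
open import Relation.Nullary using (¬_; yes; no)
open import Relation.Nullary.Decidable using (map′; decidable-stable)
open import Relation.Unary using (_∪_)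

open Position

size-positive : ∀ {a} {τ : Vocabulary a} (φ : Formula τ) → 1 ≤ size φ
size-positive (atom _ _) = ≤-refl
size-positive (_ ≈ _)    = ≤-refl
size-positive (¬′ φ)     = size-positive φ
size-positive (φ ∨ ψ)    = ≤-trans (size-positive φ) (m≤m+n _ _)
size-positive (φ ∧ ψ)    = ≤-trans (size-positive φ) (m≤m+n _ _)
size-positive (∃′ _ φ)   = m≤n+m 1 (size φ)
size-positive (∀′ _ φ)   = m≤n+m 1 (size φ)

literal-size : ∀ {a} {τ : Vocabulary a} {φ : Formula τ} → Literal φ → size φ ≡ 1
literal-size (atom _ _)  = refl
literal-size (eq _ _)    = refl
literal-size (¬atom _ _) = refl
literal-size (¬eq _ _)   = refl

-- Player I may move only at weights other than `1`. A binary connective costs at least two; a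
-- quantifier fits the same shape with `n` equal to `1`.
m+n≤o⇒o≢1 : ∀ {m n o} → 1 ≤ m → 1 ≤ n → m + n ≤ o → o ≢ 1
m+n≤o⇒o≢1 1≤m 1≤n m+n≤o refl = <-irrefl refl (≤-trans (+-mono-≤ 1≤m 1≤n) m+n≤o)

module _ {a ℓ : Level} {τ : Vocabulary a} where

  -- Positivity of the weight is carried along because a won position contributes a literal of size
  -- one, while `won` itself puts no bound on the weight.
  separatingFormula : (p : Position τ ℓ) → 1 ≤ weight p → WinningStrategy p →
                      ∃[ φ ] size φ ≤ weight p × Separates (left p) (right p) φ
  separatingFormula p 1≤w (won (φ , literal , sep)) =
    φ , ≤-trans (≤-reflexive (literal-size literal)) 1≤w , sep
  separatingFormula p _ (move _ _ (splitˡ u v 1≤u 1≤v refl 𝒞 𝒟 (split , _)) next)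
    with separatingFormula _ 1≤u (next true) | separatingFormula _ 1≤v (next false)
  ... | φ , φ≤u , hφ , 𝒞⊨φ , ℬ⊭φ | ψ , ψ≤v , hψ , 𝒟⊨ψ , ℬ⊭ψ =
    φ ∨ ψ , +-mono-≤ φ≤u ψ≤v , [ hφ , hψ ] ,
    (λ s s∈ → [ inj₁ ∘ 𝒞⊨φ s , inj₂ ∘ 𝒟⊨ψ s ] (split s∈)) ,
    (λ s s∈ → [ ℬ⊭φ s s∈ , ℬ⊭ψ s s∈ ])
  separatingFormula p _ (move _ _ (splitʳ u v 1≤u 1≤v refl 𝒞 𝒟 (split , _)) next)
    with separatingFormula _ 1≤u (next true) | separatingFormula _ 1≤v (next false)
  ... | φ , φ≤u , hφ , 𝒜⊨φ , 𝒞⊭φ | ψ , ψ≤v , hψ , 𝒜⊨ψ , 𝒟⊭ψ =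
    φ ∧ ψ , +-mono-≤ φ≤u ψ≤v , [ hφ , hψ ] ,
    (λ s s∈ → 𝒜⊨φ s s∈ , 𝒜⊨ψ s s∈) ,
    (λ s s∈ (s⊨φ , s⊨ψ) → [ (λ s∈𝒞 → 𝒞⊭φ s s∈𝒞 s⊨φ) , (λ s∈𝒟 → 𝒟⊭ψ s s∈𝒟 s⊨ψ) ] (split s∈))
  separatingFormula p 1≤w (move _ w≢1 (supplementˡ j F) next)
    -- The weight is positive and differs from `1`, so at least one unit remains after paying for
    -- the quantifier.
    with separatingFormula _ (∸-monoˡ-≤ 1 (≤∧≢⇒< 1≤w (w≢1 ∘ sym))) (next tt)
  ... | φ , φ≤ , h , 𝒜⊨φ , ℬ⊭φ =
    ∃′ j φ , m≤o∸n⇒m+n≤o (size φ) 1≤w φ≤ , (λ (free , k≢j) → tail k≢j (h free)) ,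
    (λ s s∈ → F s s∈ , 𝒜⊨φ _ (s , s∈ , refl)) ,
    (λ s s∈ (x , s⊨φ) → ℬ⊭φ _ (s , s∈ , x , refl) s⊨φ)
  separatingFormula p 1≤w (move _ w≢1 (supplementʳ j F) next)
    with separatingFormula _ (∸-monoˡ-≤ 1 (≤∧≢⇒< 1≤w (w≢1 ∘ sym))) (next tt)
  ... | φ , φ≤ , h , 𝒜⊨φ , ℬ⊭φ =
    ∀′ j φ , m≤o∸n⇒m+n≤o (size φ) 1≤w φ≤ , (λ (free , k≢j) → tail k≢j (h free)) ,
    (λ s s∈ x → 𝒜⊨φ _ (s , s∈ , x , refl)) ,
    (λ s s∈ s⊨φ → ℬ⊭φ _ (s , s∈ , refl) (s⊨φ (F s s∈)))

module _ {a ℓ : Level} (em : ExcludedMiddle (a ⊔ lsuc ℓ)) {τ : Vocabulary a} where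

  -- Satisfaction lives in `Set ℓ`, below the level where excluded middle is assumed; `Lift` brings
  -- the principle down.
  em↓ : ExcludedMiddle ℓ
  em↓ = map′ lower lift (em {Lift (a ⊔ lsuc ℓ) _})

  swap : Position τ ℓ → Position τ ℓ
  swap (position w 𝒜 ℬ) = position w ℬ 𝒜

  -- Negating an atom, or stripping the negation from a literal, exchanges the two sides; the
  -- stripping uses double negation elimination.
  swap-literal : (p : Position τ ℓ) → SeparatedByLiteral p → SeparatedByLiteral (swap p)
  swap-literal p (_ , atom R js  , h , pos , neg) =
    _ , ¬atom R js , h , neg , (λ s s∈ ¬s → ¬s (pos s s∈))
  swap-literal p (_ , eq i j     , h , pos , neg) =
    _ , ¬eq i j    , h , neg , (λ s s∈ ¬s → ¬s (pos s s∈))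
  swap-literal p (_ , ¬atom R js , h , pos , neg) =
    _ , atom R js  , h , (λ s → decidable-stable em↓ ∘ neg s) , pos
  swap-literal p (_ , ¬eq i j    , h , pos , neg) =
    _ , eq i j     , h , (λ s → decidable-stable em↓ ∘ neg s) , pos

  swap-strategy : (p : Position τ ℓ) → WinningStrategy p → WinningStrategy (swap p)
  swap-strategy p (won sep) = won (swap-literal p sep)
  swap-strategy p (move ¬sep w≢1 (splitˡ u v 1≤u 1≤v u+v≡w 𝒞 𝒟 split) next) =
    -- Swapping twice is the identity by computation, so a literal separating the swapped position
    -- would yield one separating `p`.
    move (¬sep ∘ swap-literal (swap p)) w≢1 (splitʳ u v 1≤u 1≤v u+v≡w 𝒞 𝒟 split)
      λ { true → swap-strategy _ (next true) ; false → swap-strategy _ (next false) }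
  swap-strategy p (move ¬sep w≢1 (splitʳ u v 1≤u 1≤v u+v≡w 𝒞 𝒟 split) next) =
    move (¬sep ∘ swap-literal (swap p)) w≢1 (splitˡ u v 1≤u 1≤v u+v≡w 𝒞 𝒟 split)
      λ { true → swap-strategy _ (next true) ; false → swap-strategy _ (next false) }
  swap-strategy p (move ¬sep w≢1 (supplementˡ j F) next) =
    move (¬sep ∘ swap-literal (swap p)) w≢1 (supplementʳ j F) λ _ → swap-strategy _ (next tt)
  swap-strategy p (move ¬sep w≢1 (supplementʳ j F) next) =
    move (¬sep ∘ swap-literal (swap p)) w≢1 (supplementˡ j F) λ _ → swap-strategy _ (next tt)

  -- The game stops as soon as some literal separates, which a compound formula does not reveal;
  -- excluded middle decides whether the planned move is made at all.
  moveUnlessWon : {p : Position τ ℓ} → weight p ≢ 1 → (m : Move p) →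
                  ((r : Reply m) → WinningStrategy (next m r)) → WinningStrategy p
  moveUnlessWon {p} w≢1 m strategies with em {SeparatedByLiteral p}
  ... | yes sep = won sep
  ... | no ¬sep = move ¬sep w≢1 m strategies

  -- The membership proof is irrelevant, so the witness comes from excluded
  -- middle and the hypothesis only refutes the negative case.
  choose : ∀ {D} (𝒜 : Class τ ℓ D) (P : ∀ s → Universe (model s) → Set ℓ) →
           (∀ s → 𝒜 s → ∃[ x ] P s x) → ChoiceFunction 𝒜
  choose 𝒜 P hyp s s∈ with em↓ {∃[ x ] P s x}
  ... | yes (x , _) = x
  ... | no ¬∃       = ⊥-elim-irr (¬∃ (hyp s s∈))

  -- Repeating the case split of `choose` makes the chosen value compute to the witness whose
  -- property is returned.
  choose-correct : ∀ {D} (𝒜 : Class τ ℓ D) (P : ∀ s → Universe (model s) → Set ℓ)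
                   (hyp : ∀ s → 𝒜 s → ∃[ x ] P s x) → ∀ s (s∈ : 𝒜 s) →
                   P s (choose 𝒜 P hyp s s∈)
  choose-correct 𝒜 P hyp s s∈ with em↓ {∃[ x ] P s x}
  ... | yes (_ , px) = px
  ... | no ¬∃        = ⊥-elim-irr (¬∃ (hyp s s∈))

  ¬∀⇒∃¬ : {A : Set ℓ} {P : A → Set ℓ} → ¬ (∀ x → P x) → ∃[ x ] ¬ P x
  ¬∀⇒∃¬ ¬∀ = decidable-stable em↓ λ ¬∃ →
    ¬∀ λ x → decidable-stable em↓ λ ¬px → ¬∃ (x , ¬px)

  strategy : ∀ {D} (𝒜 ℬ : Class τ ℓ D) {w} (φ : Formula τ) → size φ ≤ w →
             Separates 𝒜 ℬ φ → WinningStrategy (position w 𝒜 ℬ)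
  strategy 𝒜 ℬ (atom R js) _ sep = won (_ , atom R js , sep)
  strategy 𝒜 ℬ (i ≈ j) _ sep = won (_ , eq i j , sep)
  strategy 𝒜 ℬ (¬′ φ) φ≤w (h , pos , neg) =
    swap-strategy _ (strategy ℬ 𝒜 φ φ≤w (h , (λ s → decidable-stable em↓ ∘ neg s) , pos))
  strategy 𝒜 ℬ {w} (φ ∨ ψ) size≤w (h , pos , neg) =
    moveUnlessWon (m+n≤o⇒o≢1 (size-positive φ) (size-positive ψ) size≤w)
      -- The first part gets exactly the size of `φ`; all slack in `w` goes to `ψ`, so that the
      -- weights add up to `w`.
      (splitˡ (size φ) (w ∸ size φ) (size-positive φ)
        (≤-trans (size-positive ψ) ψ≤) (m+[n∸m]≡n (m+n≤o⇒m≤o (size φ) size≤w)) 𝒞 𝒟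
        ( (λ {s} s∈ → map (s∈ ,_) (s∈ ,_) (pos s s∈))
        , [ proj₁ , proj₁ ]))
      λ { true  → strategy 𝒞 ℬ φ ≤-refl (h ∘ inj₁ , (λ _ → proj₂) , λ s s∈ → neg s s∈ ∘ inj₁)
        ; false → strategy 𝒟 ℬ ψ ψ≤ (h ∘ inj₂ , (λ _ → proj₂) , λ s s∈ → neg s s∈ ∘ inj₂) }
    where
    ψ≤ : size ψ ≤ w ∸ size φ
    ψ≤ = m+n≤o⇒m≤o∸n (size ψ) (≤-trans (≤-reflexive (+-comm (size ψ) (size φ))) size≤w)
    𝒞 𝒟 : Class τ ℓ _
    𝒞 s = 𝒜 s × s ⊨ φ [ h ∘ inj₁ ]
    𝒟 s = 𝒜 s × s ⊨ ψ [ h ∘ inj₂ ]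
  strategy 𝒜 ℬ {w} (φ ∧ ψ) size≤w (h , pos , neg) =
    moveUnlessWon (m+n≤o⇒o≢1 (size-positive φ) (size-positive ψ) size≤w)
      (splitʳ (size φ) (w ∸ size φ) (size-positive φ)
        (≤-trans (size-positive ψ) ψ≤) (m+[n∸m]≡n (m+n≤o⇒m≤o (size φ) size≤w)) 𝒞 𝒟
        (split , [ proj₁ , proj₁ ]))
      λ { true  → strategy 𝒜 𝒞 φ ≤-refl (h ∘ inj₁ , (λ s → proj₁ ∘ pos s) , λ _ → proj₂)
        ; false → strategy 𝒜 𝒟 ψ ψ≤ (h ∘ inj₂ , (λ s → proj₂ ∘ pos s) , λ _ → proj₂) }
    where
    ψ≤ : size ψ ≤ w ∸ size φ
    ψ≤ = m+n≤o⇒m≤o∸n (size ψ) (≤-trans (≤-reflexive (+-comm (size ψ) (size φ))) size≤w)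
    𝒞 𝒟 : Class τ ℓ _
    𝒞 s = ℬ s × ¬ s ⊨ φ [ h ∘ inj₁ ]
    𝒟 s = ℬ s × ¬ s ⊨ ψ [ h ∘ inj₂ ]
    split : ∀ {s} → ℬ s → (𝒞 ∪ 𝒟) s
    -- A structure satisfying `φ` must refute `ψ`, since it refutes the conjunction; deciding `φ`
    -- thus places it in a part.
    split {s} s∈ with em↓ {s ⊨ φ [ h ∘ inj₁ ]}
    ... | yes s⊨φ = inj₂ (s∈ , λ s⊨ψ → neg s s∈ (s⊨φ , s⊨ψ))
    ... | no s⊭φ  = inj₁ (s∈ , s⊭φ)
  strategy 𝒜 ℬ (∃′ j φ) size≤w (h , pos , neg) =
    moveUnlessWon (m+n≤o⇒o≢1 (size-positive φ) ≤-refl size≤w) (supplementˡ j (choose 𝒜 P pos))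
      λ _ → strategy _ _ φ (m+n≤o⇒m≤o∸n (size φ) size≤w)
        ( bind j φ h
        , (λ { _ (s , s∈ , refl) → choose-correct 𝒜 P pos s s∈ })
        , (λ { _ (s , s∈ , x , refl) s⊨φ → neg s s∈ (x , s⊨φ) }))
    where
    P : ∀ s → Universe (model s) → Set ℓ
    P s x = update s x j ⊨ φ [ bind j φ h ]
  strategy 𝒜 ℬ (∀′ j φ) size≤w (h , pos , neg) =
    moveUnlessWon (m+n≤o⇒o≢1 (size-positive φ) ≤-refl size≤w)
      -- In each structure on the right, player I picks a counterexample to the universal formula,
      -- so `φ` fails at the picked value.
      (supplementʳ j (choose ℬ P counterexample))
      λ _ → strategy _ _ φ (m+n≤o⇒m≤o∸n (size φ) size≤w)
        ( bind j φ h
        , (λ { _ (s , s∈ , x , refl) → pos s s∈ x })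
        , (λ { _ (s , s∈ , refl) → choose-correct ℬ P counterexample s s∈ }))
    where
    P : ∀ s → Universe (model s) → Set ℓ
    P s x = ¬ update s x j ⊨ φ [ bind j φ h ]
    counterexample : ∀ s → ℬ s → ∃[ x ] P s x
    counterexample s s∈ = ¬∀⇒∃¬ (neg s s∈)

theorem10 : ∀ {a ℓ : Level} → ExcludedMiddle (a ⊔ lsuc ℓ) →
    (τ : Vocabulary a) (D : Domain) (𝒜 ℬ : Class τ ℓ D) (w : ℕ) → 1 ≤ w →
    WinningStrategy (position w 𝒜 ℬ) ⇔ (∃[ φ ] size φ ≤ w × Separates 𝒜 ℬ φ)
theorem10 em τ D 𝒜 ℬ w 1≤w =
  mk⇔ (separatingFormula _ 1≤w) λ (φ , φ≤w , sep) → strategy em 𝒜 ℬ φ φ≤w sep
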